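{- The graph $L_{6,1}$ has a perfect partition; that is, the set of all $265$ derangements of $\{1,\dots,6\}$ (equivalently, all $6\times 6$ permutation matrices with zero diagonal) can be partitioned into subsets each of which consists of $5$ permutation matrices summing to $J_6-I_6$.
   Context: $L_{n,1}=K_{n,n}-nK_{1,1}$ is the complete bipartite graph $K_{n,n}$ with a perfect matching removed; its biadjacency matrix is $J_n-I_n$, where $J_n$ is the all-ones $n\times n$ matrix. Its perfect matchings correspond exactly to derangements of $\{1,\dots,n\}$ (permutation matrices $P$ with $P\le J_n-I_n$ entrywise). A regular bipartite graph $G$ has a perfect partition if its set of perfect matchings can be partitioned into parts each of which is a $1$-factorization of $G$ (a set of pairwise edge-disjoint perfect matchings whose union is $G$); in matrix language, the set of permutation matrices $P\le A(G)$ can be partitioned into subsets each summing to $A(G)$. -}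

module Defs where

open import Data.Bool.Base using (if_then_else_)
open import Data.Fin.Base using (Fin)
open import Data.Fin.Permutation using (Permutation′; _⟨$⟩ʳ_; _≈_)
open import Data.Fin.Properties using (_≟_)
open import Data.Fin.Subset using (Subset; ⊤; ⁅_⁆; _∈_; _─_; ∣_∣)
open import Data.Integer.Base using (ℤ; 0ℤ; 1ℤ; _+_; _-_)
open import Data.List.Base using (List; []; concat; foldr)
open import Data.List.Relation.Unary.All using (All)
open import Data.List.Relation.Unary.AllPairs using (AllPairs)
open import Data.List.Relation.Unary.Any using (Any)
open import Data.Nat.Base using (ℕ)
open import Data.Product.Base using (∃; ∃-syntax; _×_)
open import Data.Vec.Base using (Vec; lookup; map; replicate; tabulate; zipWith)
open import Function.Bundles using (_⇔_)
open import Level using (Level; 0ℓ; _⊔_)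
open import Relation.Binary.Bundles using (Setoid)
open import Relation.Binary.PropositionalEquality using (_≡_; _≢_; refl; sym; trans; setoid)
open import Relation.Nullary.Decidable.Core using (does)
open import Relation.Nullary.Negation.Core using (¬_)
open import Relation.Unary using (Pred)
import Data.List.Membership.Setoid as Membership
import Data.List.Relation.Unary.Unique.Setoid as Uniqueness

private
  variable
    a ℓ p : Level
    n : ℕ

-- The set { x | P x } is the disjoint union of the listed parts. Duplicate-freeness
-- of the concatenation says both that each list has no repetitions, so that it is a
-- set, and that different parts are disjoint.
record IsPartition (S : Setoid a ℓ) (P : Pred (Setoid.Carrier S) p)
                   (parts : List (List (Setoid.Carrier S))) : Set (a ⊔ ℓ ⊔ p) where
  open Membership S using () renaming (_∈_ to _∈ₗ_)
  open Uniqueness S using (Unique)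
  field
    nonempty : All (_≢ []) parts
    disjoint : Unique (concat parts)
    covers   : ∀ x → P x ⇔ (x ∈ₗ concat parts)

-- A bipartite graph whose two colour classes are copies of Fin n; row i is the set of
-- (right) neighbours of the left vertex i. Spanning subgraphs, in particular perfect
-- matchings, are represented in the same way.
BipGraph : ℕ → Set
BipGraph n = Vec (Subset n) n

Edge : BipGraph n → Fin n → Fin n → Set
Edge G i j = j ∈ lookup G i

leftDegree rightDegree : BipGraph n → Fin n → ℕ
leftDegree  G i = ∣ lookup G i ∣
rightDegree G j = ∣ map (λ row → lookup row j) G ∣

Regular : ℕ → BipGraph n → Set
Regular d G = (∀ i → leftDegree G i ≡ d) × (∀ j → rightDegree G j ≡ d)

PerfectMatching : BipGraph n → BipGraph n → Set
PerfectMatching G M = (∀ i j → Edge M i j → Edge G i j) × Regular 1 M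

EdgeDisjoint : BipGraph n → BipGraph n → Set
EdgeDisjoint M N = ∀ i j → ¬ (Edge M i j × Edge N i j)

record IsOneFactorization (G : BipGraph n) (F : List (BipGraph n)) : Set where
  field
    matchings    : All (PerfectMatching G) F
    edgeDisjoint : AllPairs EdgeDisjoint F
    union        : ∀ i j → Edge G i j ⇔ Any (λ M → Edge M i j) F

record HasPerfectPartition (G : BipGraph n) : Set where
  field
    regular        : ∃[ d ] Regular d G
    parts          : List (List (BipGraph n))
    partition      : IsPartition (setoid (BipGraph n)) (PerfectMatching G) parts
    factorizations : All (IsOneFactorization G) parts

completeBipartite : (n : ℕ) → BipGraph n
completeBipartite n = replicate n ⊤

-- n K₁,₁, realised as the perfect matching joining each left i to the right i.
diagonalMatching : (n : ℕ) → BipGraph n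
diagonalMatching n = tabulate ⁅_⁆

-- Lₙ,₁ = Kₙ,ₙ − n K₁,₁
L₁ : (n : ℕ) → BipGraph n
L₁ n = zipWith _─_ (completeBipartite n) (diagonalMatching n)

Matrix : ℕ → Set
Matrix n = Vec (Vec ℤ n) n

matrix : (Fin n → Fin n → ℤ) → Matrix n
matrix f = tabulate λ i → tabulate λ j → f i j

δ : Fin n → Fin n → ℤ
δ i j = if does (i ≟ j) then 1ℤ else 0ℤ

0ᴹ J I : (n : ℕ) → Matrix n
0ᴹ n = matrix λ _ _ → 0ℤ
J  n = matrix λ _ _ → 1ℤ
I  n = matrix δ

infixl 6 _+ᴹ_ _-ᴹ_

_+ᴹ_ _-ᴹ_ : Matrix n → Matrix n → Matrix n
_+ᴹ_ = zipWith (zipWith _+_)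
_-ᴹ_ = zipWith (zipWith _-_)

sumᴹ : List (Matrix n) → Matrix n
sumᴹ {n} = foldr _+ᴹ_ (0ᴹ n)

permMatrix : Permutation′ n → Matrix n
permMatrix π = matrix λ i j → δ (π ⟨$⟩ʳ i) j

IsPermMatrix : Matrix n → Set
IsPermMatrix M = ∃ λ π → M ≡ permMatrix π

ZeroDiagonal : Matrix n → Set
ZeroDiagonal M = ∀ i → lookup (lookup M i) i ≡ 0ℤ

Derangement : Permutation′ n → Set
Derangement π = ∀ i → π ⟨$⟩ʳ i ≢ i

permSetoid : ℕ → Setoid 0ℓ 0ℓ
permSetoid n = record
  { Carrier       = Permutation′ n
  ; _≈_           = _≈_
  ; isEquivalence = record
    { refl  = λ _ → refl
    ; sym   = λ π≈ρ i → sym (π≈ρ i)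
    ; trans = λ π≈ρ ρ≈σ i → trans (π≈ρ i) (ρ≈σ i)
    }
  }

{-# OPTIONS --safe #-}
-- View the six points as the projective line over 𝔽₅: 0F … 4F are the elements of 𝔽₅ and
-- 5F is the point at infinity. The affine group x ↦ ax + b acts on derangements by
-- conjugation and maps 1-factorizations to 1-factorizations. Six orbits of 1-factorizations,
-- of sizes 1, 1, 1, 10, 20 and 20 with representatives found by an exact cover search,
-- consist of 53 · 5 = 265 pairwise distinct derangements; as there are only 265
-- derangements, all of them occur. Sending a permutation to its matrix, or to its perfect
-- matching, carries the partition over to matrices and graphs.
module Submission where

open import Data.Fin.Base using (Fin; zero; suc; punchIn; toℕ)
open import Data.Fin.Patterns using (0F; 1F; 2F; 3F; 4F; 5F)
open import Data.Fin.Permutation using (Permutation′; permutation; id; flip; transpose; insert; remove; insert-remove; insert-punchIn; inverseˡ; inverseʳ; _∘ₚ_; _⟨$⟩ʳ_; _⟨$⟩ˡ_; _≈_)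
open import Data.Fin.Properties using (_≟_; all?)
open import Data.Fin.Subset using (Subset; inside; outside; ⊤; ⊥; ⁅_⁆; _∈_; _∉_; _─_; ∣_∣)
open import Data.Fin.Subset.Properties using (x∈⁅x⁆; x∈⁅y⁆⇒x≡y; x≢y⇒x∉⁅y⁆; ∣⁅x⁆∣≡1; ∈⊤; ⊆-antisym; x∈p∧x∉q⇒x∈p─q; drop-there)
open import Data.Integer.Base using (0ℤ; 1ℤ)
import Data.Integer.Properties as ℤ
open import Data.List.Base using (List; []; _∷_; _++_; allFin; cartesianProductWith; concat; concatMap; filter; foldr; iterate; length; map)
open import Data.List.Membership.Propositional.Properties using (∈-allFin)
import Data.List.Membership.Setoid as Membership
import Data.List.Membership.Setoid.Properties as Membershipₚ
open import Data.List.Properties using (concat-map; length-removeAt′; map-cong)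
open import Data.List.Relation.Unary.All as All using (All)
import Data.List.Relation.Unary.All.Properties as Allₚ
open import Data.List.Relation.Unary.AllPairs as AllPairs using (AllPairs; []; _∷_)
import Data.List.Relation.Unary.AllPairs.Properties as AllPairsₚ
open import Data.List.Relation.Unary.Any as Any using (Any; here; there)
import Data.List.Relation.Unary.Any.Properties as Anyₚ
open import Data.List.Relation.Unary.Unique.Setoid using (Unique)
import Data.List.Relation.Unary.Unique.Setoid.Properties as Uniqueₚ
open import Data.Nat.Base using (ℕ; zero; suc; _+_; _*_; _≤_; z≤n; s≤s)
import Data.Nat.Properties as ℕ
open import Data.Product.Base using (Σ-syntax; ∃; _×_; _,_; proj₁; proj₂)
open import Data.Unit.Base using (tt)
open import Data.Vec.Base as Vec using ([]; _∷_; lookup; tabulate)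
import Data.Vec.Properties as Vecₚ
open import Function.Base using (_∘_)
open import Function.Bundles using (_⇔_; mk⇔; Equivalence)
open import Level using (Level)
open import Relation.Binary.Bundles using (Setoid)
open import Relation.Binary.PropositionalEquality using (_≡_; _≢_; refl; sym; trans; cong; subst; setoid)
open import Relation.Nullary.Decidable using (Dec; yes; no; toWitness; ¬?; _×-dec_; _→-dec_)
open import Relation.Nullary.Negation using (¬_; contradiction)
open import Relation.Unary using (Pred; Decidable)
open import Defs

private
  variable
    a b ℓ ℓ₁ ℓ₂ p q : Level
    n : ℕ

open Equivalence using (to; from)

-- Counting in setoids

module _ (S : Setoid a ℓ) where
  open Setoid S using () renaming (_≈_ to _≈ₛ_; sym to ≈-sym; trans to ≈-trans)
  open Membership S using () renaming (_∈_ to _∈ₛ_; _─_ to _─ₛ_)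

  ∈-─⁺ : ∀ {x y xs} (x∈xs : x ∈ₛ xs) → ¬ (x ≈ₛ y) → y ∈ₛ xs → y ∈ₛ xs ─ₛ x∈xs
  ∈-─⁺ (here x≈z)   x≉y (here y≈z)   = contradiction (≈-trans x≈z (≈-sym y≈z)) x≉y
  ∈-─⁺ (here _)     _   (there y∈xs) = y∈xs
  ∈-─⁺ (there _)    _   (here y≈z)   = here y≈z
  ∈-─⁺ (there x∈xs) x≉y (there y∈xs) = there (∈-─⁺ x∈xs x≉y y∈xs)

  -- Pigeonhole by induction on `xs`: deleting from `ys` one occurrence of the head shortens it by
  -- exactly one, and by uniqueness the tail still lies in what remains.
  unique-⊆⇒length-≤ : ∀ {xs ys} → Unique S xs → (∀ {z} → z ∈ₛ xs → z ∈ₛ ys) → length xs ≤ length ys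
  unique-⊆⇒length-≤ {[]}              _               _     = z≤n
  unique-⊆⇒length-≤ {x ∷ xs} {ys} (x∉xs ∷ unique) xs⊆ys =
    subst (suc (length xs) ≤_) (sym (length-removeAt′ ys (Any.index x∈ys)))
      (s≤s (unique-⊆⇒length-≤ unique λ z∈xs →
        ∈-─⁺ x∈ys (λ x≈z → All.lookupWith (λ x≉y z≈y → x≉y (≈-trans x≈z z≈y)) x∉xs z∈xs)
          (xs⊆ys (there z∈xs))))
    where
    x∈ys : x ∈ₛ ys
    x∈ys = xs⊆ys (here (Setoid.refl S))

  -- An element `z` of `ys` missing from `xs` would make `z ∷ xs` a duplicate-free list inside `ys`
  -- and longer than it.
  unique-⊆-length⇒⊇ : (∀ x y → Dec (x ≈ₛ y)) → ∀ {xs ys} → Unique S xs →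
    (∀ {z} → z ∈ₛ xs → z ∈ₛ ys) → length ys ≤ length xs → ∀ {z} → z ∈ₛ ys → z ∈ₛ xs
  unique-⊆-length⇒⊇ _≟ₛ_ {xs} {ys} unique xs⊆ys ys≤xs {z} z∈ys with Any.any? (z ≟ₛ_) xs
  ... | yes z∈xs = z∈xs
  ... | no  z∉xs = contradiction
    (ℕ.≤-trans (unique-⊆⇒length-≤ (Allₚ.¬Any⇒All¬ xs z∉xs ∷ unique) z∷xs⊆ys) ys≤xs) (ℕ.n≮n _)
    where
    z∷xs⊆ys : ∀ {y} → y ∈ₛ z ∷ xs → y ∈ₛ ys
    z∷xs⊆ys (here y≈z)   = Membershipₚ.∈-resp-≈ S (≈-sym y≈z) z∈ys
    z∷xs⊆ys (there y∈xs) = xs⊆ys y∈xs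

-- Transporting partitions

module _ (S : Setoid a ℓ₁) (T : Setoid b ℓ₂) where
  private
    module S = Setoid S
    module T = Setoid T

  -- Since `concat` commutes with `map`, uniqueness follows from injectivity of `f`, and coverage
  -- from `Q` being the image of `P`. It serves for matrices and graphs alike.
  IsPartition-map :
    {P : Pred S.Carrier p} {Q : Pred T.Carrier q} (f : S.Carrier → T.Carrier) →
    (∀ x y → x S.≈ y → f x T.≈ f y) → (∀ x y → f x T.≈ f y → x S.≈ y) →
    (∀ y → Q y ⇔ (Σ[ x ∈ S.Carrier ] P x × y T.≈ f x)) →
    ∀ {parts} → IsPartition S P parts → IsPartition T Q (map (map f) parts)
  IsPartition-map {P = P} {Q} f f-cong f-injective Q⇔image {parts} partition = record
    { nonempty = Allₚ.map⁺ (All.map map-nonempty nonempty)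
    ; disjoint = subst (Unique T) (sym concat≡) (Uniqueₚ.map⁺ S T (f-injective _ _) disjoint)
    ; covers   = λ y → subst (λ ys → Q y ⇔ (y ∈ₜ ys)) (sym concat≡) (mk⇔ (covered y) (sound y))
    }
    where
    open IsPartition partition
    open Membership T using () renaming (_∈_ to _∈ₜ_)

    concat≡ : concat (map (map f) parts) ≡ map f (concat parts)
    concat≡ = concat-map parts

    map-nonempty : ∀ {xs} → xs ≢ [] → map f xs ≢ []
    map-nonempty {[]}    xs≢[] _  = xs≢[] refl
    map-nonempty {_ ∷ _} _     ()

    covered : ∀ y → Q y → y ∈ₜ map f (concat parts)
    covered y Qy with to (Q⇔image y) Qy
    ... | x , Px , y≈fx = Membershipₚ.∈-resp-≈ T (T.sym y≈fx)
                            (Membershipₚ.∈-map⁺ S T (f-cong _ _) (to (covers x) Px))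

    sound : ∀ y → y ∈ₜ map f (concat parts) → Q y
    sound y y∈ with Membershipₚ.∈-map⁻ S T y∈
    ... | x , x∈ , y≈fx = from (Q⇔image y) (x , from (covers x) x∈ , y≈fx)

-- Permutation matrices

lookup-matrix : (f : Fin n → Fin n → _) → ∀ i j → lookup (lookup (matrix f) i) j ≡ f i j
lookup-matrix f i j = trans
  (cong (λ row → lookup row j) (Vecₚ.lookup∘tabulate (λ i → tabulate (f i)) i))
  (Vecₚ.lookup∘tabulate (f i) j)

δ-refl : (i : Fin n) → δ i i ≡ 1ℤ
δ-refl i with i ≟ i
... | yes _   = refl
... | no  i≢i = contradiction refl i≢i

δ≡1⇒≡ : (i j : Fin n) → δ i j ≡ 1ℤ → i ≡ j
δ≡1⇒≡ i j δ≡1 with i ≟ j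
... | yes i≡j = i≡j
δ≡1⇒≡ i j () | no _

≢⇒δ≡0 : (i j : Fin n) → i ≢ j → δ i j ≡ 0ℤ
≢⇒δ≡0 i j i≢j with i ≟ j
... | yes i≡j = contradiction i≡j i≢j
... | no  _   = refl

permMatrix-cong : (π ρ : Permutation′ n) → π ≈ ρ → permMatrix π ≡ permMatrix ρ
permMatrix-cong π ρ π≈ρ = Vecₚ.tabulate-cong λ i → cong (λ k → tabulate (δ k)) (π≈ρ i)

-- Compare the entries at `(i , π i)`: the left one is 1, and the right one is 1 only if `ρ i`
-- equals `π i`.
permMatrix-injective : (π ρ : Permutation′ n) → permMatrix π ≡ permMatrix ρ → π ≈ ρ
permMatrix-injective π ρ eq i = sym (δ≡1⇒≡ (ρ ⟨$⟩ʳ i) (π ⟨$⟩ʳ i) (trans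
  (sym (lookup-matrix (λ i j → δ (ρ ⟨$⟩ʳ i) j) i (π ⟨$⟩ʳ i)))
  (trans (cong (λ M → lookup (lookup M i) (π ⟨$⟩ʳ i)) (sym eq))
    (trans (lookup-matrix (λ i j → δ (π ⟨$⟩ʳ i) j) i (π ⟨$⟩ʳ i)) (δ-refl (π ⟨$⟩ʳ i))))))

zeroDiagonal⇔derangement : (π : Permutation′ n) → ZeroDiagonal (permMatrix π) ⇔ Derangement π
zeroDiagonal⇔derangement π = mk⇔
  (λ zd i πi≡i → contradiction
    (trans (sym (zd i)) (trans (diagonal i) (trans (cong (λ k → δ k i) πi≡i) (δ-refl i)))) λ ())
  (λ der i → trans (diagonal i) (≢⇒δ≡0 (π ⟨$⟩ʳ i) i (der i)))
  where
  diagonal : ∀ i → lookup (lookup (permMatrix π) i) i ≡ δ (π ⟨$⟩ʳ i) i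
  diagonal i = lookup-matrix (λ i j → δ (π ⟨$⟩ʳ i) j) i i

permMatrix-image : (M : Matrix n) →
  (IsPermMatrix M × ZeroDiagonal M) ⇔ (Σ[ π ∈ Permutation′ n ] Derangement π × M ≡ permMatrix π)
permMatrix-image M = mk⇔
  (λ { ((π , refl) , zd) → π , to (zeroDiagonal⇔derangement π) zd , refl })
  (λ { (π , der , refl) → (π , refl) , from (zeroDiagonal⇔derangement π) der })

-- Perfect matchings

∣p∣≡0⇒p≡⊥ : (p : Subset n) → ∣ p ∣ ≡ 0 → p ≡ ⊥
∣p∣≡0⇒p≡⊥ []            _  = refl
∣p∣≡0⇒p≡⊥ (outside ∷ p) eq = cong (outside ∷_) (∣p∣≡0⇒p≡⊥ p eq)

∣p∣≡1⇒p≡⁅x⁆ : (p : Subset n) → ∣ p ∣ ≡ 1 → ∃ λ x → p ≡ ⁅ x ⁆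
∣p∣≡1⇒p≡⁅x⁆ (inside  ∷ p) eq = zero , cong (inside ∷_) (∣p∣≡0⇒p≡⊥ p (ℕ.suc-injective eq))
∣p∣≡1⇒p≡⁅x⁆ (outside ∷ p) eq with ∣p∣≡1⇒p≡⁅x⁆ p eq
... | x , p≡⁅x⁆ = suc x , cong (outside ∷_) p≡⁅x⁆

x∈p─q⇒x∉q : (p q : Subset n) {x : Fin n} → x ∈ p ─ q → x ∉ q
x∈p─q⇒x∉q (_ ∷ p) (outside ∷ q) {suc x} x∈ x∈q = x∈p─q⇒x∉q p q (drop-there x∈) (drop-there x∈q)
x∈p─q⇒x∉q (_ ∷ p) (inside  ∷ q) {suc x} x∈ x∈q = x∈p─q⇒x∉q p q (drop-there x∈) (drop-there x∈q)
x∈p─q⇒x∉q (_ ∷ p) (inside  ∷ q) {zero}  ()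
x∈p─q⇒x∉q (_ ∷ p) (outside ∷ q) {zero}  _  ()

edge-L₁ : (i j : Fin n) → Edge (L₁ n) i j ⇔ i ≢ j
edge-L₁ {n} i j rewrite Vecₚ.lookup-zipWith _─_ i (completeBipartite n) (diagonalMatching n)
                      | Vecₚ.lookup-replicate i (⊤ {n})
                      | Vecₚ.lookup∘tabulate (⁅_⁆ {n}) i = mk⇔
  (λ { j∈ refl → x∈p─q⇒x∉q ⊤ ⁅ i ⁆ j∈ (x∈⁅x⁆ i) })
  (λ i≢j → x∈p∧x∉q⇒x∈p─q ∈⊤ (x≢y⇒x∉⁅y⁆ (i≢j ∘ sym)))

column : BipGraph n → Fin n → Subset n
column M j = Vec.map (λ row → lookup row j) M

∈-column : (M : BipGraph n) (i j : Fin n) → i ∈ column M j ⇔ Edge M i j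
∈-column M i j = mk⇔
  (λ i∈ → Vecₚ.lookup⇒[]= j (lookup M i) (trans (sym lookup-column) (Vecₚ.[]=⇒lookup i∈)))
  (λ e → Vecₚ.lookup⇒[]= i (column M j) (trans lookup-column (Vecₚ.[]=⇒lookup e)))
  where
  lookup-column : lookup (column M j) i ≡ lookup (lookup M i) j
  lookup-column = Vecₚ.lookup-map i (λ row → lookup row j) M

matching : Permutation′ n → BipGraph n
matching π = tabulate λ i → ⁅ π ⟨$⟩ʳ i ⁆

edge-matching : (π : Permutation′ n) (i j : Fin n) → Edge (matching π) i j ⇔ π ⟨$⟩ʳ i ≡ j
edge-matching π i j rewrite Vecₚ.lookup∘tabulate (λ i → ⁅ π ⟨$⟩ʳ i ⁆) i = mk⇔
  (λ j∈ → sym (x∈⁅y⁆⇒x≡y _ j∈))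
  (λ { refl → x∈⁅x⁆ _ })

matching-cong : (π ρ : Permutation′ n) → π ≈ ρ → matching π ≡ matching ρ
matching-cong π ρ π≈ρ = Vecₚ.tabulate-cong λ i → cong ⁅_⁆ (π≈ρ i)

matching-injective : (π ρ : Permutation′ n) → matching π ≡ matching ρ → π ≈ ρ
matching-injective π ρ eq i = sym (to (edge-matching ρ i (π ⟨$⟩ʳ i))
  (subst (λ M → Edge M i (π ⟨$⟩ʳ i)) eq (from (edge-matching π i (π ⟨$⟩ʳ i)) refl)))

-- The column of `j` is the singleton of the preimage of `j` under `π`.
matching-regular : (π : Permutation′ n) → Regular 1 (matching π)
matching-regular π =
  (λ i → trans (cong ∣_∣ (Vecₚ.lookup∘tabulate (λ i → ⁅ π ⟨$⟩ʳ i ⁆) i)) (∣⁅x⁆∣≡1 (π ⟨$⟩ʳ i))) ,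
  (λ j → trans (cong ∣_∣ (column≡ j)) (∣⁅x⁆∣≡1 (π ⟨$⟩ˡ j)))
  where
  column≡ : ∀ j → column (matching π) j ≡ ⁅ π ⟨$⟩ˡ j ⁆
  column≡ j = ⊆-antisym
    (λ {i} i∈ → subst (λ k → i ∈ ⁅ k ⁆)
      (trans (sym (inverseˡ π)) (cong (π ⟨$⟩ˡ_) (to (edge-matching π i j) (to (∈-column _ i j) i∈))))
      (x∈⁅x⁆ i))
    (λ {i} i∈ → from (∈-column _ i j) (from (edge-matching π i j)
      (trans (cong (π ⟨$⟩ʳ_) (x∈⁅y⁆⇒x≡y _ i∈)) (inverseʳ π))))

-- Every row and every column is a singleton. Reading off their elements gives maps `f` and `g`,
-- mutually inverse because each edge is the only one at either of its endpoints.
regular₁⇒matching : (M : BipGraph n) → Regular 1 M → ∃ λ π → M ≡ matching π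
regular₁⇒matching M (left , right) =
  permutation f g
    (λ j → sym (edge⇒f (to (∈-column M (g j) j) (g∈ j))))
    (λ i → sym (edge⇒g (f∈ i))) ,
  trans (sym (Vecₚ.tabulate∘lookup M)) (Vecₚ.tabulate-cong λ i → proj₂ (row i))
  where
  row : ∀ i → ∃ λ j → lookup M i ≡ ⁅ j ⁆
  row i = ∣p∣≡1⇒p≡⁅x⁆ (lookup M i) (left i)

  col : ∀ j → ∃ λ i → column M j ≡ ⁅ i ⁆
  col j = ∣p∣≡1⇒p≡⁅x⁆ (column M j) (right j)

  f g : Fin _ → Fin _
  f i = proj₁ (row i)
  g j = proj₁ (col j)

  f∈ : ∀ i → Edge M i (f i)
  f∈ i = subst (f i ∈_) (sym (proj₂ (row i))) (x∈⁅x⁆ (f i))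

  g∈ : ∀ j → g j ∈ column M j
  g∈ j = subst (g j ∈_) (sym (proj₂ (col j))) (x∈⁅x⁆ (g j))

  edge⇒f : ∀ {i j} → Edge M i j → j ≡ f i
  edge⇒f {i} {j} e = x∈⁅y⁆⇒x≡y (f i) (subst (j ∈_) (proj₂ (row i)) e)

  edge⇒g : ∀ {i j} → Edge M i j → i ≡ g j
  edge⇒g {i} {j} e = x∈⁅y⁆⇒x≡y (g j) (subst (i ∈_) (proj₂ (col j)) (from (∈-column M i j) e))

matching-perfect : (π : Permutation′ n) → Derangement π → PerfectMatching (L₁ n) (matching π)
matching-perfect π der =
  (λ i j e → from (edge-L₁ i j) λ i≡j → der i (trans (to (edge-matching π i j) e) (sym i≡j))) ,
  matching-regular π

-- Regularity of degree 1 supplies the permutation; a fixed point would be a diagonal edge, and `L₁`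
-- has none.
matching-image : (M : BipGraph n) →
  PerfectMatching (L₁ n) M ⇔ (Σ[ π ∈ Permutation′ n ] Derangement π × M ≡ matching π)
matching-image M = mk⇔ forward λ { (π , der , refl) → matching-perfect π der }
  where
  forward : PerfectMatching (L₁ _) M → ∃ λ π → Derangement π × M ≡ matching π
  forward (M⊆L₁ , regular) with regular₁⇒matching M regular
  ... | π , refl = π , (λ i πi≡i →
        to (edge-L₁ i i) (M⊆L₁ i i (from (edge-matching π i i) πi≡i)) refl) , refl

-- Together with the identity, the members of F are the rows of a Latin square.
Factorizes : List (Permutation′ n) → Set
Factorizes {n} F =
  All Derangement F ×
  AllPairs (λ π ρ → ∀ i → π ⟨$⟩ʳ i ≢ ρ ⟨$⟩ʳ i) F ×
  (∀ i j → i ≢ j → Any (λ π → π ⟨$⟩ʳ i ≡ j) F)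

-- With `π i ≡ j` read as an edge from `i` to `j`, the components of `Factorizes` translate into the
-- fields; that the union stays inside `L₁ n` comes from `matchings`.
factorizes⇒oneFactorization : {F : List (Permutation′ n)} →
  Factorizes F → IsOneFactorization (L₁ n) (map matching F)
factorizes⇒oneFactorization {n} {F} (derangements , disjoint , transitive) = record
  { matchings    = matchings
  ; edgeDisjoint = AllPairsₚ.map⁺ (AllPairs.map
      (λ {π} {ρ} π#ρ i j (e , e′) → π#ρ i
        (trans (to (edge-matching π i j) e) (sym (to (edge-matching ρ i j) e′)))) disjoint)
  ; union        = λ i j → mk⇔
      (λ e → Anyₚ.map⁺ (Any.map (λ {π} → from (edge-matching π i j))
        (transitive i j (to (edge-L₁ i j) e))))
      (λ any → let (_ , M∈ , e) = Membership.find (setoid _) any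
               in proj₁ (All.lookup matchings M∈) i j e)
  }
  where
  matchings : All (PerfectMatching (L₁ n)) (map matching F)
  matchings = Allₚ.map⁺ (All.map (λ {π} → matching-perfect π) derangements)

-- Enumeration of permutations

allPermutations : (n : ℕ) → List (Permutation′ n)
allPermutations zero    = id ∷ []
allPermutations (suc n) = cartesianProductWith (insert zero) (allFin (suc n)) (allPermutations n)

insert-cong : (j : Fin (suc n)) (π ρ : Permutation′ n) → π ≈ ρ → insert zero j π ≈ insert zero j ρ
insert-cong j π ρ π≈ρ zero    = refl
insert-cong j π ρ π≈ρ (suc i) = trans (insert-punchIn zero j π i)
  (trans (cong (punchIn j) (π≈ρ i)) (sym (insert-punchIn zero j ρ i)))

-- A permutation is determined by the image of `zero` and by what remains after removing `zero`. The
-- induction finds the latter only up to `≈`, hence `insert-cong`.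
allPermutations-complete : (π : Permutation′ n) → Any (π ≈_) (allPermutations n)
allPermutations-complete {zero}  π = here λ ()
allPermutations-complete {suc n} π = Anyₚ.cartesianProductWith⁺ (insert zero)
  (λ { {y = ρ} refl eq i → trans (sym (insert-remove zero π i))
                        (insert-cong (π ⟨$⟩ʳ zero) (remove zero π) ρ eq i) })
  (∈-allFin (π ⟨$⟩ʳ zero)) (allPermutations-complete (remove zero π))

derangement? : (π : Permutation′ n) → Dec (Derangement π)
derangement? π = all? λ i → ¬? (π ⟨$⟩ʳ i ≟ i)

derangement-resp-≈ : (π ρ : Permutation′ n) → π ≈ ρ → Derangement π → Derangement ρ
derangement-resp-≈ π ρ π≈ρ der i ρi≡i = der i (trans (π≈ρ i) ρi≡i)

derangements : (n : ℕ) → List (Permutation′ n)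
derangements n = filter derangement? (allPermutations n)

derangements-complete : (π : Permutation′ n) → Derangement π → Any (π ≈_) (derangements n)
derangements-complete {n} π = Membershipₚ.∈-filter⁺ (permSetoid n) derangement?
  (λ {ρ} {σ} → derangement-resp-≈ ρ σ) {v = π} (allPermutations-complete π)

_≈?_ : (π ρ : Permutation′ n) → Dec (π ≈ ρ)
π ≈? ρ = all? λ i → π ⟨$⟩ʳ i ≟ ρ ⟨$⟩ʳ i

-- The word π 0, π 1, …, read as a number in base n.
code : Permutation′ n → ℕ
code {n} π = foldr (λ i c → toℕ i + n * c) 0 (map (π ⟨$⟩ʳ_) (allFin n))

-- Used contrapositively: different codes force inequivalent permutations, so distinctness can be
-- tested on numbers.
code-cong : (π ρ : Permutation′ n) → π ≈ ρ → code π ≡ code ρ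
code-cong {n} π ρ π≈ρ = cong (foldr (λ i c → toℕ i + n * c) 0) (map-cong π≈ρ (allFin n))

-- The partition

-- `_∘ₚ_` applies its left factor first: for distinct entries, the inner cycle fixes `i`, which then
-- goes to `j`, while the last entry goes to `j` and on to `i`.
cycle : List (Fin n) → Permutation′ n
cycle []           = id
cycle (_ ∷ [])     = id
cycle (i ∷ j ∷ is) = cycle (j ∷ is) ∘ₚ transpose i j

cycles : List (List (Fin n)) → Permutation′ n
cycles = foldr (λ c π → cycle c ∘ₚ π) id

-- Relabelling of the points: the cycles of the result are the images under `σ` of the cycles of
-- `π`.
conjugate : Permutation′ n → Permutation′ n → Permutation′ n
conjugate σ π = flip σ ∘ₚ π ∘ₚ σ

-- The maps x ↦ x + 1 and x ↦ 2x, fixing infinity. As 2 has order 4 modulo 5, they generate the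
-- affine group, of order 20.
translation doubling : Permutation′ 6
translation = cycle (0F ∷ 1F ∷ 2F ∷ 3F ∷ 4F ∷ [])
doubling    = cycle (1F ∷ 2F ∷ 4F ∷ 3F ∷ [])

translates : Permutation′ 6 → List (Permutation′ 6)
translates π = iterate (conjugate translation) π 5

-- Every affine map is a power of doubling followed by a translation, so `k = 4` runs through the
-- whole group.
orbit : ℕ → List (Permutation′ 6) → List (List (Permutation′ 6))
orbit k F = concatMap (λ G → iterate (map (conjugate translation)) G 5)
                      (iterate (map (conjugate doubling)) F k)

-- The subscripts are orbit sizes. Negation exchanges the first and fourth members of `F₁₀`,
-- exchanges the second and third, and fixes the fifth.
F₁₀ F₂₀ F₂₀′ : List (Permutation′ 6)
F₁₀ =
  cycles ((0F ∷ 1F ∷ 4F ∷ 5F ∷ 2F ∷ 3F ∷ []) ∷ []) ∷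
  cycles ((0F ∷ 2F ∷ 5F ∷ 4F ∷ []) ∷ (1F ∷ 3F ∷ []) ∷ []) ∷
  cycles ((0F ∷ 3F ∷ 5F ∷ 1F ∷ []) ∷ (2F ∷ 4F ∷ []) ∷ []) ∷
  cycles ((0F ∷ 4F ∷ 1F ∷ 5F ∷ 3F ∷ 2F ∷ []) ∷ []) ∷
  cycles ((0F ∷ 5F ∷ []) ∷ (1F ∷ 2F ∷ []) ∷ (3F ∷ 4F ∷ []) ∷ []) ∷ []
F₂₀ =
  cycles ((0F ∷ 1F ∷ []) ∷ (2F ∷ 3F ∷ 4F ∷ 5F ∷ []) ∷ []) ∷
  cycles ((0F ∷ 2F ∷ 4F ∷ []) ∷ (1F ∷ 5F ∷ 3F ∷ []) ∷ []) ∷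
  cycles ((0F ∷ 3F ∷ 5F ∷ 1F ∷ 4F ∷ 2F ∷ []) ∷ []) ∷
  cycles ((0F ∷ 4F ∷ 1F ∷ 3F ∷ 2F ∷ 5F ∷ []) ∷ []) ∷
  cycles ((0F ∷ 5F ∷ 4F ∷ 3F ∷ []) ∷ (1F ∷ 2F ∷ []) ∷ []) ∷ []
F₂₀′ =
  cycles ((0F ∷ 1F ∷ 2F ∷ []) ∷ (3F ∷ 4F ∷ 5F ∷ []) ∷ []) ∷
  cycles ((0F ∷ 2F ∷ 1F ∷ 3F ∷ 5F ∷ 4F ∷ []) ∷ []) ∷
  cycles ((0F ∷ 3F ∷ 2F ∷ 4F ∷ 1F ∷ 5F ∷ []) ∷ []) ∷
  cycles ((0F ∷ 4F ∷ 3F ∷ 1F ∷ []) ∷ (2F ∷ 5F ∷ []) ∷ []) ∷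
  cycles ((0F ∷ 5F ∷ 1F ∷ 4F ∷ 2F ∷ 3F ∷ []) ∷ []) ∷ []

-- Opaque because unification would otherwise expand the whole list of permutations.
opaque
  -- Conjugation by x ↦ −x = doubling² fixes F₁₀, so two of the four powers of doubling
  -- already give its whole orbit.
  parts₆ : List (List (Permutation′ 6))
  parts₆ =
    -- These three swap 0 and infinity and multiply the other points by a = -1, 2, 3. The translate
    -- by t swaps t and infinity and sends any other x to ax + (1 - a)t; as a ≠ 1, for finite i ≠ j
    -- exactly one t sends i to j.
    translates (cycles ((0F ∷ 5F ∷ []) ∷ (1F ∷ 4F ∷ []) ∷ (2F ∷ 3F ∷ []) ∷ [])) ∷
    translates (cycles ((0F ∷ 5F ∷ []) ∷ (1F ∷ 2F ∷ 4F ∷ 3F ∷ []) ∷ [])) ∷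
    translates (cycles ((0F ∷ 5F ∷ []) ∷ (1F ∷ 3F ∷ 4F ∷ 2F ∷ []) ∷ [])) ∷
    orbit 2 F₁₀ ++ orbit 4 F₂₀ ++ orbit 4 F₂₀′

factorizes? : (F : List (Permutation′ n)) → Dec (Factorizes F)
factorizes? F =
  All.all? derangement? F ×-dec
  AllPairs.allPairs? (λ π ρ → all? λ i → ¬? (π ⟨$⟩ʳ i ≟ ρ ⟨$⟩ʳ i)) F ×-dec
  all? (λ i → all? λ j → ¬? (i ≟ j) →-dec Any.any? (λ π → π ⟨$⟩ʳ i ≟ j) F)

opaque
  unfolding parts₆

  parts₆-factorize : All Factorizes parts₆
  parts₆-factorize = toWitness {a? = All.all? factorizes? parts₆} tt

  parts₆-disjoint : Unique (permSetoid 6) (concat parts₆)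
  parts₆-disjoint = Uniqueₚ.map⁻ (permSetoid 6) (setoid ℕ) (λ {π} {ρ} → code-cong π ρ)
    (toWitness {a? = AllPairs.allPairs? (λ c d → ¬? (c ℕ.≟ d)) (map code (concat parts₆))} tt)

  parts₆-sum : All (λ F → length F ≡ 5 × sumᴹ (map permMatrix F) ≡ J 6 -ᴹ I 6) parts₆
  parts₆-sum = toWitness {a? = All.all? (λ F → (length F ℕ.≟ 5) ×-dec
    Vecₚ.≡-dec (Vecₚ.≡-dec ℤ._≟_) (sumᴹ (map permMatrix F)) (J 6 -ᴹ I 6)) parts₆} tt

  parts₆-nonempty : All (_≢ []) parts₆
  parts₆-nonempty = toWitness {a? = All.all? nonempty? parts₆} tt
    where
    nonempty? : Decidable {A = List (Permutation′ 6)} (_≢ [])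
    nonempty? []      = no λ []≢[] → []≢[] refl
    nonempty? (_ ∷ _) = yes λ ()

  parts₆-length : length (concat parts₆) ≡ 265
  parts₆-length = refl

-- By evaluation. As the enumeration is complete, its length bounds the number of derangements from
-- above.
derangements-length : length (derangements 6) ≡ 265
derangements-length = refl

parts₆-partition : IsPartition (permSetoid 6) Derangement parts₆
parts₆-partition = record
  { nonempty = parts₆-nonempty
  ; disjoint = parts₆-disjoint
  ; covers   = λ π → mk⇔ (covered π ∘ derangements-complete π) (sound π)
  }
  where
  open Membership (permSetoid 6) using () renaming (_∈_ to _∈ₚ_)

  sound : ∀ π → π ∈ₚ concat parts₆ → Derangement π
  sound π = All.lookupWith (λ {ρ} der π≈ρ → derangement-resp-≈ ρ π (λ i → sym (π≈ρ i)) der)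
    (Allₚ.concat⁺ (All.map proj₁ parts₆-factorize))

  length≡ : length (derangements 6) ≡ length (concat parts₆)
  length≡ = trans derangements-length (sym parts₆-length)

  -- The parts form a duplicate-free list inside the complete list of derangements and have the same
  -- length, so counting reverses the inclusion.
  covered : ∀ π → π ∈ₚ derangements 6 → π ∈ₚ concat parts₆
  covered π = unique-⊆-length⇒⊇ (permSetoid 6) _≈?_ {concat parts₆} {derangements 6} parts₆-disjoint
    (λ {ρ} ρ∈ → derangements-complete ρ (sound ρ ρ∈)) (ℕ.≤-reflexive length≡) {π}

L₁-regular : Regular 5 (L₁ 6)
L₁-regular = toWitness {a? = all? (λ i → leftDegree (L₁ 6) i ℕ.≟ 5)
                       ×-dec all? (λ j → rightDegree (L₁ 6) j ℕ.≟ 5)} tt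

theorem2p1 : HasPerfectPartition (L₁ 6)
    × (Σ[ parts ∈ List (List (Permutation′ 6)) ]
    IsPartition (permSetoid 6) Derangement parts
    × IsPartition (setoid (Matrix 6)) (λ M → IsPermMatrix M × ZeroDiagonal M) (map (map permMatrix) parts)
    × length (concat parts) ≡ 265
    × All (λ F → length F ≡ 5 × sumᴹ (map permMatrix F) ≡ J 6 -ᴹ I 6) parts)
theorem2p1 =
  record
    { regular        = 5 , L₁-regular
    ; parts          = map (map matching) parts₆
    ; partition      = IsPartition-map (permSetoid 6) (setoid _) matching
                         matching-cong matching-injective matching-image parts₆-partition
    ; factorizations = Allₚ.map⁺ (All.map factorizes⇒oneFactorization parts₆-factorize)
    } ,
  parts₆ ,
  parts₆-partition ,
  IsPartition-map (permSetoid 6) (setoid _) permMatrix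
    permMatrix-cong permMatrix-injective permMatrix-image parts₆-partition ,
  parts₆-length ,
  parts₆-sum
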